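{- Let $\mathcal{U}$ be a free ultrafilter on $\omega=\{0,1,\ldots\}$. If, for every transitive group $G$ of permutations of $\omega$, $\mathcal{U}$ is $G$-selective with respect to the natural action of $G$ on $\omega$, then $\mathcal{U}$ is selective.
   Context: An ultrafilter is free if it is non-principal. A free ultrafilter $\mathcal{U}$ on an infinite set $X$ is selective if, for any partition $\mathcal{P}$ of $X$, either one cell of $\mathcal{P}$ is a member of $\mathcal{U}$, or some member of $\mathcal{U}$ meets each cell of $\mathcal{P}$ in at most one point. A group $G$ of permutations of $\omega$ is transitive if for any $x,y\in\omega$ there is $g\in G$ with $gx=y$. If a group $G$ acts transitively on an infinite set $X$, a partition $\mathcal{P}$ of $X$ is $G$-invariant if $gP\in\mathcal{P}$ for all $g\in G$ and $P\in\mathcal{P}$; a free ultrafilter $\mathcal{U}$ on $X$ is $G$-selective if, for every $G$-invariant partition $\mathcal{P}$ of $X$, either some cell of $\mathcal{P}$ is a member of $\mathcal{U}$, or there exists $U\in\mathcal{U}$ such that $|P\cap U|\leqslant 1$ for each $P\in\mathcal{P}$. -}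

module Defs where

open import Data.Product using (∃; _×_)
open import Data.Sum using (_⊎_)
open import Function.Bundles using (_↔_; _⇔_; module Inverse)
open import Function.Construct.Composition using (_↔-∘_)
open import Function.Construct.Identity using (↔-id)
open import Function.Construct.Symmetry using (↔-sym)
open import Level using (0ℓ)
open import Relation.Binary.Core using (Rel)
open import Relation.Binary.Definitions using (_Respects_)
open import Relation.Binary.PropositionalEquality using (_≡_; _≗_)
open import Relation.Nullary using (¬_)
open import Relation.Unary
  using (Pred; _∈_; _⊆_; _≐_; _∩_; _≬_; U; ∁; Satisfiable)

Subset : Set → Set₁
Subset X = Pred X 0ℓ

Family : Set → Set₁
Family X = Pred (Subset X) 0ℓ

-- Properness (∅ ∉ 𝓤) is stated positively: every member is inhabited.
-- Applied to constant subsets, `ultra` then decides every Q : Set, so the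
-- ultrafilter itself supplies the classical logic of the ambient set theory.
record IsFilter {X : Set} (𝓤 : Family X) : Set₁ where
  field
    whole    : U ∈ 𝓤
    nonempty : ∀ {A} → A ∈ 𝓤 → Satisfiable A
    ∩-closed : ∀ {A B} → A ∈ 𝓤 → B ∈ 𝓤 → (A ∩ B) ∈ 𝓤
    ⊆-closed : ∀ {A B} → A ⊆ B → A ∈ 𝓤 → B ∈ 𝓤

record IsUltrafilter {X : Set} (𝓤 : Family X) : Set₁ where
  field
    isFilter : IsFilter 𝓤
    ultra    : ∀ A → A ∈ 𝓤 ⊎ ∁ A ∈ 𝓤

Principal : {X : Set} → Family X → Set₁
Principal 𝓤 = ∃ λ x → ∀ A → A ∈ 𝓤 ⇔ x ∈ A

Free : {X : Set} → Family X → Set₁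
Free 𝓤 = ¬ Principal 𝓤

-- Subsets are compared by extensional equality _≐_, so a set of cells has to
-- respect it.
record IsPartition {X : Set} (𝓟 : Family X) : Set₁ where
  field
    respects-≐ : 𝓟 Respects _≐_
    nonempty   : ∀ {P} → P ∈ 𝓟 → Satisfiable P
    covers     : ∀ x → ∃ λ P → P ∈ 𝓟 × x ∈ P
    disjoint   : ∀ {P Q} → P ∈ 𝓟 → Q ∈ 𝓟 → P ≬ Q → P ≐ Q

AtMostOnePoint : {X : Set} → Subset X → Set
AtMostOnePoint A = ∀ {x y} → x ∈ A → y ∈ A → x ≡ y

SelectiveFor : {X : Set} → Family X → Family X → Set₁
SelectiveFor 𝓤 𝓟 =
  (∃ λ P → P ∈ 𝓟 × P ∈ 𝓤) ⊎
  (∃ λ A → A ∈ 𝓤 × (∀ {P} → P ∈ 𝓟 → AtMostOnePoint (P ∩ A)))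

Selective : {X : Set} → Family X → Set₁
Selective 𝓤 = ∀ 𝓟 → IsPartition 𝓟 → SelectiveFor 𝓤 𝓟

Permutation : Set → Set
Permutation X = X ↔ X

-- Two permutations count as equal when they agree pointwise.
_≈ₚ_ : {X : Set} → Rel (Permutation X) 0ℓ
g ≈ₚ h = Inverse.to g ≗ Inverse.to h

record IsPermutationGroup {X : Set} (G : Pred (Permutation X) 0ℓ) : Set where
  field
    respects-≈ : G Respects _≈ₚ_
    id-closed  : ↔-id X ∈ G
    ∘-closed   : ∀ {g h} → g ∈ G → h ∈ G → (g ↔-∘ h) ∈ G
    ⁻¹-closed  : ∀ {g} → g ∈ G → ↔-sym g ∈ G

Transitive : {X : Set} → Pred (Permutation X) 0ℓ → Set
Transitive G = ∀ x y → ∃ λ g → g ∈ G × Inverse.to g x ≡ y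

image : {X : Set} → Permutation X → Subset X → Subset X
image g A y = ∃ λ x → x ∈ A × Inverse.to g x ≡ y

Invariant : {X : Set} → Pred (Permutation X) 0ℓ → Family X → Set₁
Invariant G 𝓟 = ∀ {g P} → g ∈ G → P ∈ 𝓟 → image g P ∈ 𝓟

GSelective : {X : Set} → Pred (Permutation X) 0ℓ → Family X → Set₁
GSelective G 𝓤 =
  ∀ 𝓟 → IsPartition 𝓟 → Invariant G 𝓟 → SelectiveFor 𝓤 𝓟

{-# OPTIONS --safe #-}
-- Choose φ : ω ↔ ω × ω whose column A = φ⁻¹({0} × ω) belongs to 𝓤, and label
-- each cell of 𝓟 by its least element; let r x be the label of the cell of x.
-- Applying to row m of ω × ω the transposition (0 r(φ⁻¹(0,m))) of first
-- coordinates gives another bijection ψ : ω ↔ ω × ω, and proj₁ ∘ ψ = r on A.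
-- So the partition into the columns of ψ agrees with 𝓟 on A, while its
-- stabiliser is transitive because all its cells have the same cardinality.
module Submission where

open import Defs
open import Data.Nat using (ℕ; zero; suc; _≤_; z≤n; s≤s; _≟_)
open import Data.Nat.Binary using (ℕᵇ; zero; 2[1+_]; 1+[2_]; toℕ; fromℕ)
open import Data.Nat.Binary.Properties using (toℕ-fromℕ; fromℕ-toℕ)
open import Data.Nat.Properties using (≤-antisym; ≟-diag)
open import Data.Product using (∃; _×_; _,_; proj₁; proj₂; map₁)
open import Data.Product.Function.NonDependent.Propositional using (_×-↔_)
open import Data.Sum using (inj₁; inj₂; [_,_]′)
open import Function using (_∘_)
open import Function.Bundles
  using (_↔_; _⇔_; mk↔ₛ′; mk⇔; module Inverse; module Injection; module Equivalence)
open import Function.Construct.Composition using (_↔-∘_; _⇔-∘_)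
open import Function.Construct.Identity using (⇔-id)
open import Function.Construct.Symmetry using (↔-sym; ⇔-sym)
open import Function.Properties.Inverse using (↔⇒↣)
open import Level using (0ℓ)
open import Relation.Binary.PropositionalEquality
  using (_≡_; refl; sym; trans; cong; cong₂; subst₂; module ≡-Reasoning)
open import Relation.Nullary using (¬_; Dec; yes; no; contradiction)
open import Relation.Unary using (Pred; Decidable; _∈_; _⊆_; _≐_; _∩_; _≬_)
open import Relation.Unary.Properties using (≐-refl; ≐-sym; ≐-trans)

open Inverse using (to; from; strictlyInverseˡ; strictlyInverseʳ)

-- Transpositions of ω

transpose : ℕ → ℕ → ℕ → ℕ
transpose i j k with k ≟ i | k ≟ j
... | yes _ | _     = j
... | no _  | yes _ = i
... | no _  | no _  = k

transpose-matchˡ : ∀ i j → transpose i j i ≡ j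
transpose-matchˡ i j rewrite ≟-diag (refl {x = i}) = refl

transpose-matchʳ : ∀ i j → transpose i j j ≡ i
transpose-matchʳ i j with j ≟ i
... | yes j≡i = j≡i
... | no _ rewrite ≟-diag (refl {x = j}) = refl

transpose-involutive : ∀ i j k → transpose i j (transpose i j k) ≡ k
transpose-involutive i j k with k ≟ i | k ≟ j
... | yes refl | _        = transpose-matchʳ k j
... | no _     | yes refl = transpose-matchˡ i k
-- The inner call has now reduced to `k`, which leaves `transpose i j k ≡ k`; its two tests arise
-- only at this point and have to be decided again.
... | no k≢i   | no k≢j   with k ≟ i | k ≟ j
...   | yes k≡i | _       = contradiction k≡i k≢i
...   | no _    | yes k≡j = contradiction k≡j k≢j
...   | no _    | no _    = refl

transposition : ℕ → ℕ → Permutation ℕ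
transposition i j = mk↔ₛ′ (transpose i j) (transpose i j)
  (transpose-involutive i j) (transpose-involutive i j)

-- (k , m) is sent to the number with k ones at its low end followed by 2 m, in
-- bijective base 2.
pairᵇ : ℕ × ℕ → ℕᵇ
pairᵇ (zero  , zero)  = zero
pairᵇ (zero  , suc m) = 2[1+ fromℕ m ]
pairᵇ (suc k , m)     = 1+[2 pairᵇ (k , m) ]

unpairᵇ : ℕᵇ → ℕ × ℕ
unpairᵇ zero     = zero , zero
unpairᵇ 2[1+ x ] = zero , suc (toℕ x)
unpairᵇ 1+[2 x ] = map₁ suc (unpairᵇ x)

unpairᵇ-pairᵇ : ∀ p → unpairᵇ (pairᵇ p) ≡ p
unpairᵇ-pairᵇ (zero  , zero)  = refl
unpairᵇ-pairᵇ (zero  , suc m) = cong (λ n → zero , suc n) (toℕ-fromℕ m)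
unpairᵇ-pairᵇ (suc k , m)     = cong (map₁ suc) (unpairᵇ-pairᵇ (k , m))

pairᵇ-unpairᵇ : ∀ x → pairᵇ (unpairᵇ x) ≡ x
pairᵇ-unpairᵇ zero     = refl
pairᵇ-unpairᵇ 2[1+ x ] = cong 2[1+_] (fromℕ-toℕ x)
pairᵇ-unpairᵇ 1+[2 x ] = cong 1+[2_] (pairᵇ-unpairᵇ x)

ℕ↔ℕ×ℕ : ℕ ↔ (ℕ × ℕ)
ℕ↔ℕ×ℕ = mk↔ₛ′ unpairᵇ pairᵇ unpairᵇ-pairᵇ pairᵇ-unpairᵇ
  ↔-∘ mk↔ₛ′ fromℕ toℕ fromℕ-toℕ toℕ-fromℕ

-- The columns other than column 0 together form a copy of ω × ω, which `ℕ↔ℕ×ℕ` matches with column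
-- 0. The resulting involution exchanges column 0 with its complement.
swapZeroColumn : Permutation (ℕ × ℕ)
swapZeroColumn = mk↔ₛ′ f f involutive involutive
  where
  f : ℕ × ℕ → ℕ × ℕ
  f (zero  , m) = map₁ suc (to ℕ↔ℕ×ℕ m)
  f (suc k , m) = zero , from ℕ↔ℕ×ℕ (k , m)

  involutive : ∀ p → f (f p) ≡ p
  involutive (zero  , m) = cong (zero ,_) (strictlyInverseʳ ℕ↔ℕ×ℕ m)
  involutive (suc k , m) = cong (map₁ suc) (strictlyInverseˡ ℕ↔ℕ×ℕ (k , m))

least : {P : Pred ℕ 0ℓ} → Decidable P → ∀ n → n ∈ P →
  ∃ λ m → m ∈ P × (∀ {k} → k ∈ P → m ≤ k)
least P? zero    p = zero , p , λ _ → z≤n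
least P? (suc n) p with P? zero
... | yes p₀ = zero , p₀ , λ _ → z≤n
... | no ¬p₀ with m , q , m-min ← least (P? ∘ suc) n p =
  suc m , q , λ { {zero} p₀ → contradiction p₀ ¬p₀ ; {suc _} p′ → s≤s (m-min p′) }

-- Partitions into fibres and their stabilisers

module _ {X : Set} (c : X → ℕ) where

  Fibre : ℕ → Subset X
  Fibre n x = c x ≡ n

  Fibres : Family X
  Fibres P = ∃ λ n → P ≐ Fibre n

  Fibres-isPartition : (∀ n → ∃ λ x → c x ≡ n) → IsPartition Fibres
  Fibres-isPartition c-surjective = record
    { respects-≐ = λ P≐Q (n , P≐F) → n , ≐-trans (≐-sym P≐Q) P≐F
    ; nonempty   = λ (n , P≐F) → let x , cx≡n = c-surjective n in x , proj₂ P≐F cx≡n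
    ; covers     = λ x → Fibre (c x) , (c x , ≐-refl) , refl
    ; disjoint   = λ { (n , P≐F) (n′ , Q≐F) (x , x∈P , x∈Q) →
        ≐-trans P≐F (≐-trans (Fibre-cong (trans (sym (proj₁ P≐F x∈P)) (proj₁ Q≐F x∈Q)))
                             (≐-sym Q≐F)) }
    }
    where
    Fibre-cong : ∀ {m n} → m ≡ n → Fibre m ≐ Fibre n
    Fibre-cong refl = ≐-refl

  -- The setwise stabiliser of the partition: fibres may be permuted among themselves. Preserving
  -- and reflecting the relation of lying in one fibre expresses this without naming the induced map
  -- on indices.
  Stabiliser : Pred (Permutation X) 0ℓ
  Stabiliser g = ∀ x y → c x ≡ c y ⇔ c (to g x) ≡ c (to g y)

  Stabiliser-isPermutationGroup : IsPermutationGroup Stabiliser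
  Stabiliser-isPermutationGroup = record
    { respects-≈ = λ g≈h g∈ x y →
        subst₂ (λ u v → c x ≡ c y ⇔ c u ≡ c v) (g≈h x) (g≈h y) (g∈ x y)
    ; id-closed  = λ x y → ⇔-id _
    ; ∘-closed   = λ {g} {h} g∈ h∈ x y → g∈ (to h x) (to h y) ⇔-∘ h∈ x y
    ; ⁻¹-closed  = λ {g} g∈ x y →
        subst₂ (λ u v → c u ≡ c v ⇔ c (from g x) ≡ c (from g y))
          (strictlyInverseˡ g x) (strictlyInverseˡ g y)
          (⇔-sym (g∈ (from g x) (from g y)))
    }

  -- Surjectivity gives each fibre a representative `x₀`, and the image of the fibre through `x₀` is
  -- the fibre through `to g x₀`.
  Fibres-invariant : (∀ n → ∃ λ x → c x ≡ n) → Invariant Stabiliser Fibres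
  Fibres-invariant c-surjective {g} {P} g∈ (n , P≐F) with x₀ , refl ← c-surjective n =
    c (to g x₀) ,
    (λ { (x , x∈P , refl) → Equivalence.to (g∈ x x₀) (proj₁ P≐F x∈P) }) ,
    λ {y} cy≡ → from g y ,
      proj₂ P≐F (Equivalence.from (g∈ (from g y) x₀)
        (trans (cong c (strictlyInverseˡ g y)) cy≡)) ,
      strictlyInverseˡ g y

-- Columns of a bijection with ω × ω

module _ {X : Set} (ψ : X ↔ (ℕ × ℕ)) where

  column : X → ℕ
  column = proj₁ ∘ to ψ

  column-surjective : ∀ n → ∃ λ x → column x ≡ n
  column-surjective n = from ψ (n , zero) , cong proj₁ (strictlyInverseˡ ψ (n , zero))

  -- A product of two transpositions, one in each coordinate, moves any point of ω × ω to any other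
  -- and permutes whole columns; conjugating by `ψ` carries it to `X`.
  Stabiliser-transitive : Transitive (Stabiliser column)
  Stabiliser-transitive x y = g , g∈ , gx≡y
    where
    τ₁ τ₂ : Permutation ℕ
    τ₁ = transposition (column x) (column y)
    τ₂ = transposition (proj₂ (to ψ x)) (proj₂ (to ψ y))

    g : Permutation X
    g = ↔-sym ψ ↔-∘ ((τ₁ ×-↔ τ₂) ↔-∘ ψ)

    column-g : ∀ z → column (to g z) ≡ to τ₁ (column z)
    column-g z = cong proj₁ (strictlyInverseˡ ψ _)

    g∈ : g ∈ Stabiliser column
    g∈ u v = mk⇔
      (λ eq → trans (column-g u) (trans (cong (to τ₁) eq) (sym (column-g v))))
      (λ eq → Injection.injective (↔⇒↣ τ₁) (trans (sym (column-g u)) (trans eq (column-g v))))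

    gx≡y : to g x ≡ y
    gx≡y = trans
      (cong (from ψ) (cong₂ _,_ (transpose-matchˡ (column x) (column y))
                                (transpose-matchˡ (proj₂ (to ψ x)) (proj₂ (to ψ y)))))
      (strictlyInverseʳ ψ y)

-- The row-wise transpositions (0 r(φ⁻¹(0,m))) carry the column {0} × ω onto the
-- graph {(r(φ⁻¹(0,m)) , m)}.
extendToColumns : {X : Set} (φ : X ↔ (ℕ × ℕ)) (r : X → ℕ) →
  ∃ λ ψ → ∀ {x} → column φ x ≡ zero → column ψ x ≡ r x
extendToColumns φ r = shear ↔-∘ φ , column-ψ
  where
  σ : ℕ → Permutation ℕ
  σ m = transposition zero (r (from φ (zero , m)))

  shear : Permutation (ℕ × ℕ)
  shear = mk↔ₛ′ f f involutive involutive
    where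
    f : ℕ × ℕ → ℕ × ℕ
    f (k , m) = to (σ m) k , m

    involutive : ∀ p → f (f p) ≡ p
    involutive (k , m) = cong (_, m) (strictlyInverseˡ (σ m) k)

  column-ψ : ∀ {x} → column φ x ≡ zero → to (σ (proj₂ (to φ x))) (column φ x) ≡ r x
  column-ψ {x} eq = begin
    to (σ m) (column φ x)      ≡⟨ cong (to (σ m)) eq ⟩
    to (σ m) zero              ≡⟨ transpose-matchˡ zero _ ⟩
    r (from φ (zero , m))      ≡⟨ cong (λ k → r (from φ (k , m))) eq ⟨
    r (from φ (to φ x))        ≡⟨ cong r (strictlyInverseʳ φ x) ⟩
    r x                        ∎
    where
    open ≡-Reasoning
    m = proj₂ (to φ x)

-- From an ultrafilter to a large column

module _ {X : Set} {𝓤 : Family X} (𝓤-ultra : IsUltrafilter 𝓤) where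
  open IsUltrafilter 𝓤-ultra
  open IsFilter isFilter

  excludedMiddle : (Q : Set) → Dec Q
  excludedMiddle Q = [ yes ∘ proj₂ ∘ nonempty , no ∘ proj₂ ∘ nonempty ]′ (ultra (λ _ → Q))

  zeroColumn∈ : X ↔ (ℕ × ℕ) → ∃ λ (φ : X ↔ (ℕ × ℕ)) → Fibre (column φ) zero ∈ 𝓤
  zeroColumn∈ φ with ultra (Fibre (column φ) zero)
  ... | inj₁ A∈𝓤  = φ , A∈𝓤
  -- The large complement of column 0 becomes column 0 of the new bijection.
  ... | inj₂ Aᶜ∈𝓤 = swapZeroColumn ↔-∘ φ , ⊆-closed (λ {x} → swapped (to φ x)) Aᶜ∈𝓤
    where
    swapped : ∀ p → ¬ proj₁ p ≡ zero → proj₁ (to swapZeroColumn p) ≡ zero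
    swapped (zero  , m) p≢0 = contradiction refl p≢0
    swapped (suc k , m) p≢0 = refl

-- Transfer of selectivity to the given partition

module _ {X : Set} {𝓟 : Family X} (𝓟-partition : IsPartition 𝓟) where
  open IsPartition 𝓟-partition

  cell : X → Subset X
  cell x = proj₁ (covers x)

  cell∈ : ∀ x → cell x ∈ 𝓟
  cell∈ x = proj₁ (proj₂ (covers x))

  ∈cell : ∀ x → x ∈ cell x
  ∈cell x = proj₂ (proj₂ (covers x))

  -- Surjectivity is not demanded, so some numbers may label no cell.
  Labels : (X → ℕ) → Set
  Labels r = ∀ x y → r x ≡ r y ⇔ y ∈ cell x

  -- Fibres of `c` and cells of `𝓟` have the same traces on `A`, so intersecting with `A` transfers
  -- either alternative.
  selectiveFor-fibres⇒selectiveFor : {𝓤 : Family X} → IsFilter 𝓤 →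
    ∀ {r c A} → Labels r → A ∈ 𝓤 → (∀ {x} → x ∈ A → c x ≡ r x) →
    SelectiveFor 𝓤 (Fibres c) → SelectiveFor 𝓤 𝓟
  selectiveFor-fibres⇒selectiveFor 𝓤-filter {r} {c} {A} labels A∈𝓤 c≡r (inj₁ (P , (n , P≐F) , P∈𝓤)) =
    inj₁ (cell x , cell∈ x , F.⊆-closed P∩A⊆cell P∩A∈𝓤)
    where
    module F = IsFilter 𝓤-filter
    P∩A∈𝓤 = F.∩-closed P∈𝓤 A∈𝓤
    -- Any point of `P ∩ A` identifies the cell that contains all of `P ∩ A`.
    x = proj₁ (F.nonempty P∩A∈𝓤)

    r≡n : ∀ {y} → y ∈ P ∩ A → r y ≡ n
    r≡n (y∈P , y∈A) = trans (sym (c≡r y∈A)) (proj₁ P≐F y∈P)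

    P∩A⊆cell : P ∩ A ⊆ cell x
    P∩A⊆cell {y} y∈ = Equivalence.to (labels x y)
      (trans (r≡n (proj₂ (F.nonempty P∩A∈𝓤))) (sym (r≡n y∈)))
  selectiveFor-fibres⇒selectiveFor 𝓤-filter {r} {c} {A} labels A∈𝓤 c≡r (inj₂ (B , B∈𝓤 , B-selects)) =
    inj₂ (A ∩ B , IsFilter.∩-closed 𝓤-filter A∈𝓤 B∈𝓤 , selects)
    where
    selects : ∀ {P} → P ∈ 𝓟 → AtMostOnePoint (P ∩ (A ∩ B))
    selects P∈𝓟 {x} {y} (x∈P , x∈A , x∈B) (y∈P , y∈A , y∈B) =
      B-selects (c x , ≐-refl) (refl , x∈B) (cy≡cx , y∈B)
      where
      y∈cell : y ∈ cell x
      y∈cell = proj₁ (disjoint P∈𝓟 (cell∈ x) (x , x∈P , ∈cell x)) y∈P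

      cy≡cx : c y ≡ c x
      cy≡cx = trans (c≡r y∈A) (trans (sym (Equivalence.from (labels x y) y∈cell)) (sym (c≡r x∈A)))

-- `covers` may present one cell by different, extensionally equal predicates at different points;
-- its least element does not depend on the presentation. Conversely, a shared least element is a
-- common point, so the cells coincide. Excluded middle makes membership decidable for the search.
leastLabels : {𝓟 : Family ℕ} (𝓟-partition : IsPartition 𝓟) →
  ((Q : Set) → Dec Q) → ∃ (Labels 𝓟-partition)
leastLabels 𝓟-partition lem = proj₁ ∘ minimum , λ x y → mk⇔ (sameCell x y) (sameLabel x y)
  where
  open IsPartition 𝓟-partition
  C : ℕ → Subset ℕ
  C = cell 𝓟-partition

  minimum : ∀ x → ∃ λ m → m ∈ C x × (∀ {k} → k ∈ C x → m ≤ k)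
  minimum x = least (λ y → lem (y ∈ C x)) x (∈cell 𝓟-partition x)

  meet⇒≐ : ∀ x y → C x ≬ C y → C x ≐ C y
  meet⇒≐ x y = disjoint (cell∈ 𝓟-partition x) (cell∈ 𝓟-partition y)

  sameCell : ∀ x y → proj₁ (minimum x) ≡ proj₁ (minimum y) → y ∈ C x
  sameCell x y eq with m , m∈x , _ ← minimum x | _ , m∈y , _ ← minimum y | refl ← eq =
    proj₂ (meet⇒≐ x y (m , m∈x , m∈y)) (∈cell 𝓟-partition y)

  sameLabel : ∀ x y → y ∈ C x → proj₁ (minimum x) ≡ proj₁ (minimum y)
  sameLabel x y y∈x with m , m∈x , m-min ← minimum x | n , n∈y , n-min ← minimum y =
    ≤-antisym (m-min (proj₂ x≐y n∈y)) (n-min (proj₁ x≐y m∈x))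
    where
    x≐y : C x ≐ C y
    x≐y = meet⇒≐ x y (y , y∈x , ∈cell 𝓟-partition y)

theorem3 : (𝓤 : Family ℕ) → IsUltrafilter 𝓤 → Free 𝓤 →
    ((G : Pred (Permutation ℕ) 0ℓ) → IsPermutationGroup G → Transitive G → GSelective G 𝓤) →
    Selective 𝓤
theorem3 𝓤 𝓤-ultra _ G-selective 𝓟 𝓟-partition =
  let r , labels = leastLabels 𝓟-partition (excludedMiddle 𝓤-ultra)
      φ , A∈𝓤    = zeroColumn∈ 𝓤-ultra ℕ↔ℕ×ℕ
      ψ , ψ≡r    = extendToColumns φ r
      c          = column ψ
  in selectiveFor-fibres⇒selectiveFor 𝓟-partition (IsUltrafilter.isFilter 𝓤-ultra) labels A∈𝓤 ψ≡r
       (G-selective (Stabiliser c) (Stabiliser-isPermutationGroup c) (Stabiliser-transitive ψ)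
         (Fibres c) (Fibres-isPartition c (column-surjective ψ))
         (λ {g} → Fibres-invariant c (column-surjective ψ) {g}))
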